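{- Let $\mathcal X=(\Omega,S)$ be a scheme with $n=|\Omega|$ such that $4c(m-1)<n$, where $c=c(\mathcal X)$ and $m=n_{\max}$. Then for every $\alpha\in\Omega$ the coherent configuration $\mathcal X_\alpha$ is $1$-regular. In particular, $b(\mathcal X)\le 2$.
   Context: A coherent configuration on a finite set $\Omega$ is $(\Omega,S)$ with $S$ a partition of $\Omega\times\Omega$ such that $1_\Omega$ is a union of elements of $S$, $s^*=\{(\beta,\alpha):(\alpha,\beta)\in s\}\in S$, and for $r,s,t\in S$ the number $|\{\gamma:(\alpha,\gamma)\in r,(\gamma,\beta)\in s\}|$ is independent of $(\alpha,\beta)\in t$; it is a scheme if $1_\Omega\in S$. Valency of $r\in S$ in a scheme: $n_r=|\{\beta:(\alpha,\beta)\in r\}|$ (independent of $\alpha$); $n_{\max}=\max_{r\in S}n_r$. For $\alpha,\beta\in\Omega$, $r(\alpha,\beta)$ is the element of $S$ containing $(\alpha,\beta)$. For $s\in S$ and $(\alpha,\beta)\in s$, the indistinguishing number $c(s)=|\{\gamma\in\Omega: r(\alpha,\gamma)=r(\beta,\gamma)\}|$ (independent of the choice of $(\alpha,\beta)$); $c(\mathcal X)$ is the maximum of $c(s)$ over $s\in S$, $s\ne 1_\Omega$. Fibers: sets $\Gamma$ with $1_\Gamma\in S$. Fission: configuration on $\Omega$ whose relations (unions of basic relations) include those of $\mathcal X$; complete: all basic relations singletons. $\mathcal X_\alpha$ is the smallest fission in which $\{\alpha\}$ is a fiber. A coherent configuration $(\Omega,T)$ is $1$-regular if some point $\gamma$ satisfies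 $|\{\delta:(\gamma,\delta)\in t\}|\le1$ for all $t\in T$. A set $B$ is a base if the smallest fission in which all $\{\beta\}$, $\beta\in B$, are fibers is complete; $b(\mathcal X)$ is the minimal size of a base. -}

module Defs where

open import Data.Bool.Base using (Bool; true)
open import Data.Fin.Base using (Fin; zero; suc; combine; remQuot)
open import Data.Fin.Properties using (_≟_; any?; all?; remQuot-combine; combine-remQuot) renaming (suc-injective to Fin-suc-injective)
open import Data.Fin.Subset using (Subset; _∈_; ⁅_⁆; ⊤; ∣_∣)
open import Data.Fin.Subset.Properties using (_∈?_; x∈⁅x⁆; x∈⁅y⁆⇒x≡y; ∈⊤; anySubset?)
open import Data.List.Base using (List; []; _∷_; _++_; map; filter; length; allFin; cartesianProduct)
open import Data.List.Extrema.Nat using (max)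
open import Data.List.Membership.Propositional as List using ()
open import Data.List.Membership.Propositional.Properties using (∈-∃++; ∈-allFin; ∈-cartesianProduct⁺; ∈-filter⁺; ∈-filter⁻)
open import Data.List.Properties using (filter-≐; filter-accept)
open import Data.List.Relation.Binary.Permutation.Propositional using (_↭_; ↭-refl; ↭-sym; ↭-trans; prep)
open import Data.List.Relation.Binary.Permutation.Propositional.Properties using (filter-↭; ↭-length; shift)
open import Data.List.Relation.Unary.Any using (here; there)
open import Data.Maybe.Base using (Maybe; just; nothing)
open import Data.Maybe.Properties using (just-injective) renaming (≡-dec to Maybe-≡-dec)
open import Data.Nat.Base using (ℕ; zero; suc; _*_; _≤_; _<_; z≤n; s≤s)
open import Data.Nat.Induction using (<-wellFounded)
open import Data.Nat.Properties using (suc-injective; m≤n⇒m≤1+n) renaming (_≟_ to _≟ℕ_)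
open import Data.Product.Base using (Σ; ∃; ∃₂; _×_; _,_; proj₁; proj₂; uncurry)
open import Data.Product.Properties using () renaming (≡-dec to ×-≡-dec)
open import Data.Vec.Base using (tabulate; lookup)
open import Data.Vec.Properties using (lookup∘tabulate; lookup⇒[]=; []=⇒lookup)
open import Function.Base using (_∘_; id)
open import Function.Bundles using (_⇔_; mk⇔; Equivalence)
open import Induction.WellFounded using (Acc; acc)
open import Level using (Level)
open import Relation.Binary.Definitions using (DecidableEquality)
open import Relation.Binary.PropositionalEquality using (_≡_; refl; sym; trans; cong; cong₂; subst)
open import Relation.Nullary using (¬_; Dec; yes; no; contradiction)
open import Relation.Nullary.Decidable using (_×-dec_; _→-dec_; ¬?; map′)
open import Relation.Unary using (Pred; Decidable)

open Equivalence using (to; from)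

private
  variable
    a p q : Level
    A K : Set a
    n : ℕ

# : {P : Pred (Fin n) p} → Decidable P → ℕ
# {n = n} P? = length (filter P? (allFin n))

-- The partition S of Ω × Ω, Ω = Fin n, is given by its classification map r
-- onto the index set Fin rank: the basic relation with index s is
-- {(α , β) : r α β ≡ s}.
record CoherentConfiguration (n : ℕ) : Set where
  field
    rank     : ℕ
    r        : Fin n → Fin n → Fin rank
    nonempty : ∀ s → ∃₂ λ α β → r α β ≡ s
    diagonal : ∃ λ (U : Subset rank) → ∀ α β → r α β ∈ U ⇔ α ≡ β
    converse : ∀ s → ∃ λ s* → ∀ α β → r β α ≡ s* ⇔ r α β ≡ s
    coherent : ∀ u v t {α β α′ β′} → r α β ≡ t → r α′ β′ ≡ t →
               # (λ γ → (r α γ ≟ u) ×-dec (r γ β ≟ v)) ≡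
               # (λ γ → (r α′ γ ≟ u) ×-dec (r γ β′ ≟ v))

record Scheme (n : ℕ) : Set where
  field
    config   : CoherentConfiguration n
  open CoherentConfiguration config public
  field
    1Ω       : Fin rank
    1Ω-equal : ∀ α β → r α β ≡ 1Ω ⇔ α ≡ β

module _ (X : CoherentConfiguration n) where
  open CoherentConfiguration X

  outdegree : Fin n → Fin rank → ℕ
  outdegree α s = # (λ β → r α β ≟ s)

  indistinguishing : Fin n → Fin n → ℕ
  indistinguishing α β = # (λ γ → r α γ ≟ r β γ)

  OneRegular : Set
  OneRegular = ∃ λ γ → ∀ t → outdegree γ t ≤ 1

  Complete : Set
  Complete = ∀ s → ∃₂ λ α β → ∀ γ δ → r γ δ ≡ s ⇔ (γ ≡ α × δ ≡ β)

  IsFiber : Subset n → Set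
  IsFiber Γ = ∃ λ s → ∀ α β → r α β ≡ s ⇔ (α ≡ β × α ∈ Γ)

-- The relations of X are the unions ⋃ U of basic relations, U : Subset rank;
-- Y is a fission of X when each of them is also a relation of Y.
IsFission : CoherentConfiguration n → CoherentConfiguration n → Set
IsFission X Y = ∀ (U : Subset X.rank) → ∃ λ (V : Subset Y.rank) →
                ∀ α β → X.r α β ∈ U ⇔ Y.r α β ∈ V
  where
  module X = CoherentConfiguration X
  module Y = CoherentConfiguration Y

IsFissionFixing : CoherentConfiguration n → Subset n → CoherentConfiguration n → Set
IsFissionFixing X B Y = IsFission X Y × (∀ β → β ∈ B → IsFiber Y ⁅ β ⁆)

IsSmallestFissionFixing : CoherentConfiguration n → Subset n → CoherentConfiguration n → Set
IsSmallestFissionFixing X B Y =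
  IsFissionFixing X B Y × (∀ Z → IsFissionFixing X B Z → IsFission Y Z)

private
  filter-map-length : {P : Pred K p} (P? : Decidable P) (f : A → K) (xs : List A) →
                      length (filter P? (map f xs)) ≡ length (filter (P? ∘ f) xs)
  filter-map-length P? f [] = refl
  filter-map-length P? f (x ∷ xs) with P? (f x)
  ... | yes _ = cong suc (filter-map-length P? f xs)
  ... | no  _ = filter-map-length P? f xs

  filter-nonempty : {P : Pred K p} (P? : Decidable P) (xs : List K) {k : ℕ} →
                    length (filter P? xs) ≡ suc k → ∃ λ x → x List.∈ xs × P x
  filter-nonempty P? (x ∷ xs) eq with P? x
  ... | yes px = x , here refl , px
  ... | no  _  with y , y∈ , py ← filter-nonempty P? xs eq = y , there y∈ , py

  length-filter-≤ : {P : Pred A p} {Q : Pred A q} (P? : Decidable P) (Q? : Decidable Q) →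
                    (∀ x → P x → Q x) → ∀ xs → length (filter P? xs) ≤ length (filter Q? xs)
  length-filter-≤ P? Q? P⊆Q [] = z≤n
  length-filter-≤ P? Q? P⊆Q (x ∷ xs) with P? x | Q? x
  ... | yes _  | yes _  = s≤s (length-filter-≤ P? Q? P⊆Q xs)
  ... | yes px | no ¬qx = contradiction (P⊆Q x px) ¬qx
  ... | no _   | yes _  = m≤n⇒m≤1+n (length-filter-≤ P? Q? P⊆Q xs)
  ... | no _   | no _   = length-filter-≤ P? Q? P⊆Q xs

  length-filter-< : {P : Pred A p} {Q : Pred A q} (P? : Decidable P) (Q? : Decidable Q) →
                    (∀ x → P x → Q x) → ∀ {x} xs → x List.∈ xs → Q x → ¬ P x →
                    length (filter P? xs) < length (filter Q? xs)
  length-filter-< P? Q? P⊆Q (x ∷ xs) (here refl) qx ¬px with P? x | Q? x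
  ... | yes px | _      = contradiction px ¬px
  ... | no _   | no ¬qx = contradiction qx ¬qx
  ... | no _   | yes _  = s≤s (length-filter-≤ P? Q? P⊆Q xs)
  length-filter-< P? Q? P⊆Q (y ∷ xs) (there x∈) qx ¬px with P? y | Q? y
  ... | yes _  | yes _  = s≤s (length-filter-< P? Q? P⊆Q xs x∈ qx ¬px)
  ... | yes py | no ¬qy = contradiction (P⊆Q y py) ¬qy
  ... | no _   | yes _  = m≤n⇒m≤1+n (length-filter-< P? Q? P⊆Q xs x∈ qx ¬px)
  ... | no _   | no _   = length-filter-< P? Q? P⊆Q xs x∈ qx ¬px

  module _ {K : Set} (_≟ᴷ_ : DecidableEquality K) where

    occ : K → List K → ℕ
    occ k = length ∘ filter (_≟ᴷ k)

    occ⇒↭ : ∀ xs ys → (∀ k → occ k xs ≡ occ k ys) → xs ↭ ys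
    occ⇒↭ [] [] _ = ↭-refl
    occ⇒↭ [] (y ∷ ys) eq
      with () ← trans (eq y) (cong length (filter-accept (_≟ᴷ y) {y} {ys} refl))
    occ⇒↭ (x ∷ xs) ys eq
      with _ , x∈ys , refl ← filter-nonempty (_≟ᴷ x) ys
             (trans (sym (eq x)) (cong length (filter-accept (_≟ᴷ x) {x} {xs} refl)))
      with us , vs , refl ← ∈-∃++ x∈ys
      = ↭-trans (prep x (occ⇒↭ xs (us ++ vs) eq′)) (↭-sym (shift x us vs))
      where
      eq∷ : ∀ k → occ k (x ∷ xs) ≡ occ k (x ∷ us ++ vs)
      eq∷ k = trans (eq k) (↭-length (filter-↭ (_≟ᴷ k) (shift x us vs)))
      eq′ : ∀ k → occ k xs ≡ occ k (us ++ vs)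
      eq′ k with e ← eq∷ k with x ≟ᴷ k
      ... | yes _ = suc-injective e
      ... | no _  = e

    #-fibrewise : {Q : Pred K q} (Q? : Decidable Q) (f g : Fin n → K) →
                  (∀ k → # (λ γ → f γ ≟ᴷ k) ≡ # (λ γ → g γ ≟ᴷ k)) →
                  # (Q? ∘ f) ≡ # (Q? ∘ g)
    #-fibrewise {n = n} Q? f g eq =
      trans (sym (filter-map-length Q? f (allFin n)))
        (trans (↭-length (filter-↭ Q? (occ⇒↭ (map f (allFin n)) (map g (allFin n)) occ≡)))
          (filter-map-length Q? g (allFin n)))
      where
      occ≡ : ∀ k → occ k (map f (allFin n)) ≡ occ k (map g (allFin n))
      occ≡ k = trans (filter-map-length (_≟ᴷ k) f (allFin n))
                 (trans (eq k) (sym (filter-map-length (_≟ᴷ k) g (allFin n))))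

#-cong : {P : Pred (Fin n) p} {Q : Pred (Fin n) q} (P? : Decidable P) (Q? : Decidable Q) →
         (∀ γ → P γ ⇔ Q γ) → # P? ≡ # Q?
#-cong {n = n} P? Q? P⇔Q =
  cong length (filter-≐ P? Q? ((λ {γ} → to (P⇔Q γ)) , (λ {γ} → from (P⇔Q γ))) (allFin n))

module _ (X : CoherentConfiguration n) where
  open CoherentConfiguration X

  r-converse : ∀ {α β α′ β′} → r α β ≡ r α′ β′ → r β α ≡ r β′ α′
  r-converse {α} {β} {α′} {β′} eq with s* , h ← converse (r α β) =
    trans (from (h α β) refl) (sym (from (h α′ β′) (sym eq)))

  r-diagonal : ∀ {α β γ} → r α α ≡ r β γ → β ≡ γ
  r-diagonal {α} {β} {γ} eq with U , h ← diagonal =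
    to (h β γ) (subst (_∈ U) eq (from (h α α) refl))

  private
    r² : Fin n → Fin n → Fin n → Fin rank × Fin rank
    r² α β γ = r α γ , r γ β

  coherent⁺ : {Q : Pred (Fin rank × Fin rank) q} (Q? : Decidable Q) →
              ∀ {α β α′ β′} → r α β ≡ r α′ β′ →
              # (λ γ → Q? (r α γ , r γ β)) ≡ # (λ γ → Q? (r α′ γ , r γ β′))
  coherent⁺ Q? {α} {β} {α′} {β′} eq =
    #-fibrewise _≟²_ Q? (r² α β) (r² α′ β′) λ (u , v) →
      trans (split α β u v) (trans (coherent u v _ refl (sym eq)) (sym (split α′ β′ u v)))
    where
    _≟²_ : DecidableEquality (Fin rank × Fin rank)
    _≟²_ = ×-≡-dec _≟_ _≟_
    split : ∀ α β u v → # (λ γ → r² α β γ ≟² (u , v)) ≡ # (λ γ → (r α γ ≟ u) ×-dec (r γ β ≟ v))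
    split α β u v = #-cong (λ γ → r² α β γ ≟² (u , v)) (λ γ → (r α γ ≟ u) ×-dec (r γ β ≟ v))
      λ γ → mk⇔ (λ e → cong proj₁ e , cong proj₂ e) (λ (e , e′) → cong₂ _,_ e e′)

  indistinguishing-cong : ∀ {α β α′ β′} → r α β ≡ r α′ β′ →
                          indistinguishing X α β ≡ indistinguishing X α′ β′
  indistinguishing-cong {α} {β} {α′} {β′} eq =
    trans (turn α β) (trans (coherent⁺ (λ (u , v) → u ≟ proj₁ (converse v)) eq) (sym (turn α′ β′)))
    where
    r-star : ∀ β γ → r β γ ≡ proj₁ (converse (r γ β))
    r-star β γ = from (proj₂ (converse (r γ β)) γ β) refl
    turn : ∀ α β → indistinguishing X α β ≡ # (λ γ → r α γ ≟ proj₁ (converse (r γ β)))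
    turn α β = #-cong (λ γ → r α γ ≟ r β γ) (λ γ → r α γ ≟ proj₁ (converse (r γ β)))
      λ γ → mk⇔ (λ e → trans e (r-star β γ)) (λ e → trans e (sym (r-star β γ)))

-- n_s and c(s) are evaluated at the pair of s supplied by nonempty;
-- valency-wd and c-wd show that the choice is immaterial.
module _ (X : Scheme n) where
  open Scheme X

  valency : Fin rank → ℕ
  valency s = outdegree config (proj₁ (nonempty s)) s

  valency-wd : ∀ α s → outdegree config α s ≡ valency s
  valency-wd α s = coherent⁺ config (λ (u , _) → u ≟ s)
    (trans (from (1Ω-equal α α) refl) (sym (from (1Ω-equal _ _) refl)))

  nₘₐₓ : ℕ
  nₘₐₓ = max 0 (map valency (allFin rank))

  c : Fin rank → ℕ
  c s = indistinguishing config (proj₁ (nonempty s)) (proj₁ (proj₂ (nonempty s)))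

  c-wd : ∀ α β → indistinguishing config α β ≡ c (r α β)
  c-wd α β = indistinguishing-cong config (sym (proj₂ (proj₂ (nonempty (r α β)))))

  -- When 1Ω is the only basic relation (n = 1) the maximum is taken to be 0.
  cₘₐₓ : ℕ
  cₘₐₓ = max 0 (map c (filter (λ s → ¬? (s ≟ 1Ω)) (allFin rank)))

infix 4 _⊑_
_⊑_ : {k l : ℕ} → (Fin n → Fin n → Fin k) → (Fin n → Fin n → Fin l) → Set
f ⊑ g = ∀ α β α′ β′ → f α β ≡ f α′ β′ → g α β ≡ g α′ β′

-- Existence of the smallest fission, by colour refinement.
private
  record Colouring (n : ℕ) : Set where
    field
      size   : ℕ
      colour : Fin n → Fin n → Fin size
      onto   : ∀ s → ∃₂ λ α β → colour α β ≡ s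

  classify : ∀ N {_~_ : Fin N → Fin N → Set} → (∀ x y → Dec (x ~ y)) →
             (∀ x → x ~ x) → (∀ {x y} → x ~ y → y ~ x) → (∀ {x y z} → x ~ y → y ~ z → x ~ z) →
             ∃ λ k → Σ (Fin N → Fin k) λ f →
               (∀ s → ∃ λ x → f x ≡ s) × (∀ x y → f x ≡ f y ⇔ x ~ y)
  classify zero _~?_ ~refl ~sym ~trans = 0 , (λ ()) , (λ ()) , λ ()
  classify (suc N) {_~_} _~?_ ~refl ~sym ~trans
    with k , f , sur , h ← classify N (λ x y → suc x ~? suc y) (λ x → ~refl (suc x)) ~sym ~trans
    with any? (λ y → zero ~? suc y)
  ... | yes (y , 0~y) = k , g , (λ s → suc (proj₁ (sur s)) , proj₂ (sur s)) , h′
    where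
    g : Fin (suc N) → Fin k
    g zero    = f y
    g (suc x) = f x
    h′ : ∀ x z → g x ≡ g z ⇔ x ~ z
    h′ zero    zero    = mk⇔ (λ _ → ~refl zero) (λ _ → refl)
    h′ zero    (suc z) = mk⇔ (λ e → ~trans 0~y (to (h y z) e)) (λ e → from (h y z) (~trans (~sym 0~y) e))
    h′ (suc x) zero    = mk⇔ (λ e → ~trans (to (h x y) e) (~sym 0~y)) (λ e → from (h x y) (~trans e 0~y))
    h′ (suc x) (suc z) = h x z
  ... | no ¬0~ = suc k , g , sur′ , h′
    where
    g : Fin (suc N) → Fin (suc k)
    g zero    = zero
    g (suc x) = suc (f x)
    sur′ : ∀ s → ∃ λ x → g x ≡ s
    sur′ zero    = zero , refl
    sur′ (suc s) = suc (proj₁ (sur s)) , cong suc (proj₂ (sur s))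
    h′ : ∀ x z → g x ≡ g z ⇔ x ~ z
    h′ zero    zero    = mk⇔ (λ _ → ~refl zero) (λ _ → refl)
    h′ zero    (suc z) = mk⇔ (λ ()) (λ e → contradiction (z , e) ¬0~)
    h′ (suc x) zero    = mk⇔ (λ ()) (λ e → contradiction (x , ~sym e) ¬0~)
    h′ (suc x) (suc z) = mk⇔ (λ e → to (h x z) (Fin-suc-injective e))
                             (λ e → cong suc (from (h x z) e))

  classify² : {_~_ : Fin n × Fin n → Fin n × Fin n → Set} → (∀ x y → Dec (x ~ y)) →
              (∀ x → x ~ x) → (∀ {x y} → x ~ y → y ~ x) → (∀ {x y z} → x ~ y → y ~ z → x ~ z) →
              Σ (Colouring n) λ C →
                ∀ α β α′ β′ → Colouring.colour C α β ≡ Colouring.colour C α′ β′ ⇔ (α , β) ~ (α′ , β′)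
  classify² {n} {_~_} _~?_ ~refl ~sym ~trans
    with k , f , sur , h ← classify (n * n) (λ x y → remQuot {n} n x ~? remQuot {n} n y)
                             (λ x → ~refl (remQuot {n} n x)) ~sym ~trans
    = record { size = k ; colour = λ α β → f (combine α β) ; onto = onto } , eqv
    where
    onto : ∀ s → ∃₂ λ α β → f (combine α β) ≡ s
    onto s with x , refl ← sur s =
      proj₁ (remQuot {n} n x) , proj₂ (remQuot {n} n x) ,
      cong f (combine-remQuot {n} n x)
    eqv : ∀ α β α′ β′ → f (combine α β) ≡ f (combine α′ β′) ⇔ (α , β) ~ (α′ , β′)
    eqv α β α′ β′ with h′ ← h (combine α β) (combine α′ β′)
      rewrite remQuot-combine {n} {n} α β | remQuot-combine {n} {n} α′ β′ = h′

  module _ (C : Colouring n) where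
    open Colouring C

    triangles : Fin n → Fin n → Fin size → Fin size → ℕ
    triangles α β u v = # (λ γ → (colour α γ ≟ u) ×-dec (colour γ β ≟ v))

    Similar : Fin n × Fin n → Fin n × Fin n → Set
    Similar (α , β) (α′ , β′) = colour α β ≡ colour α′ β′ × colour β α ≡ colour β′ α′ ×
                                (∀ u v → triangles α β u v ≡ triangles α′ β′ u v)

    similar? : ∀ x y → Dec (Similar x y)
    similar? (α , β) (α′ , β′) =
      (colour α β ≟ colour α′ β′) ×-dec (colour β α ≟ colour β′ α′) ×-dec
      all? (λ u → all? (λ v → triangles α β u v ≟ℕ triangles α′ β′ u v))

    Stable : Set
    Stable = ∀ α β α′ β′ → colour α β ≡ colour α′ β′ → Similar (α , β) (α′ , β′)

    refine : Σ (Colouring n) λ D →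
             ∀ α β α′ β′ → Colouring.colour D α β ≡ Colouring.colour D α′ β′ ⇔ Similar (α , β) (α′ , β′)
    refine = classify² similar? (λ _ → refl , refl , λ _ _ → refl)
      (λ (e , e′ , e″) → sym e , sym e′ , λ u v → sym (e″ u v))
      (λ (e , e′ , e″) (f , f′ , f″) → trans e f , trans e′ f′ , λ u v → trans (e″ u v) (f″ u v))

    SameColour : (Fin n × Fin n) × (Fin n × Fin n) → Set
    SameColour ((α , β) , (α′ , β′)) = colour α β ≡ colour α′ β′

    sameColour? : Decidable SameColour
    sameColour? ((α , β) , (α′ , β′)) = colour α β ≟ colour α′ β′

    quads : List ((Fin n × Fin n) × (Fin n × Fin n))
    quads = cartesianProduct (cartesianProduct (allFin n) (allFin n))
                             (cartesianProduct (allFin n) (allFin n))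

    ∈-quads : ∀ x → x List.∈ quads
    ∈-quads ((α , β) , (α′ , β′)) =
      ∈-cartesianProduct⁺ (∈-cartesianProduct⁺ (∈-allFin α) (∈-allFin β))
                          (∈-cartesianProduct⁺ (∈-allFin α′) (∈-allFin β′))

    measure : ℕ
    measure = length (filter sameColour? quads)

    Unstable : (Fin n × Fin n) × (Fin n × Fin n) → Set
    Unstable x = SameColour x × ¬ uncurry Similar x

    unstable? : Decidable Unstable
    unstable? x = sameColour? x ×-dec ¬? (similar? (proj₁ x) (proj₂ x))

    stable-or-not : Dec (∃ λ x → Unstable x)
    stable-or-not with filter unstable? quads in eq
    ... | x ∷ _ = yes (x , proj₂ (∈-filter⁻ unstable? {xs = quads} (subst (x List.∈_) (sym eq) (here refl))))
    ... | []    = no λ (x , ux) →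
                    contradiction (subst (x List.∈_) eq (∈-filter⁺ unstable? (∈-quads x) ux)) λ ()

    -- A configuration refining C also refines one refinement step of C.
    ⊑-similar : (Z : CoherentConfiguration n) → CoherentConfiguration.r Z ⊑ colour → ∀ α β α′ β′ →
                CoherentConfiguration.r Z α β ≡ CoherentConfiguration.r Z α′ β′ → Similar (α , β) (α′ , β′)
    ⊑-similar Z Z⊑C α β α′ β′ eq =
      Z⊑C α β α′ β′ eq , Z⊑C β α β′ α′ (r-converse Z eq) ,
      λ u v → trans (via u v α β) (trans (coherent⁺ Z (Q? u v) eq) (sym (via u v α′ β′)))
      where
      open CoherentConfiguration Z
      π : Fin rank → Fin size
      π s = colour (proj₁ (nonempty s)) (proj₁ (proj₂ (nonempty s)))
      π-r : ∀ α β → π (r α β) ≡ colour α β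
      π-r α β = Z⊑C _ _ _ _ (proj₂ (proj₂ (nonempty (r α β))))
      Q? : ∀ u v → Decidable {A = Fin rank × Fin rank} (λ (s , t) → π s ≡ u × π t ≡ v)
      Q? u v (s , t) = (π s ≟ u) ×-dec (π t ≟ v)
      via : ∀ u v α β → triangles α β u v ≡ # (λ γ → Q? u v (r α γ , r γ β))
      via u v α β = #-cong (λ γ → (colour α γ ≟ u) ×-dec (colour γ β ≟ v)) (λ γ → Q? u v (r α γ , r γ β))
        λ γ → mk⇔ (λ (e , e′) → trans (π-r α γ) e , trans (π-r γ β) e′)
                  (λ (e , e′) → trans (sym (π-r α γ)) e , trans (sym (π-r γ β)) e′)

  IsStableClosure : Colouring n → Colouring n → Set
  IsStableClosure C D =
    Stable D × Colouring.colour D ⊑ Colouring.colour C ×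
    (∀ Z → CoherentConfiguration.r Z ⊑ Colouring.colour C → CoherentConfiguration.r Z ⊑ Colouring.colour D)

  stabilise : (C : Colouring n) → Acc _<_ (measure C) → ∃ (IsStableClosure C)
  stabilise C (acc rec) with stable-or-not C
  ... | no ¬u = C , stable , (λ _ _ _ _ → id) , (λ _ → id)
    where
    stable : Stable C
    stable α β α′ β′ e with similar? C (α , β) (α′ , β′)
    ... | yes s = s
    ... | no ¬s = contradiction (((α , β) , (α′ , β′)) , e , ¬s) ¬u
  ... | yes (x , same , ¬sim) with D , h ← refine C
    with E , st , E⊑D , least ← stabilise D (rec (length-filter-< (sameColour? D) (sameColour? C)
           (λ ((α , β) , (α′ , β′)) e → proj₁ (to (h α β α′ β′) e)) (quads C) (∈-quads C x) same
           (λ e → ¬sim (to (h _ _ _ _) e))))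
    = E , st , (λ α β α′ β′ e → proj₁ (to (h α β α′ β′) (E⊑D α β α′ β′ e))) ,
      λ Z Z⊑C → least Z λ α β α′ β′ e → from (h α β α′ β′) (⊑-similar C Z Z⊑C α β α′ β′ e)

  ∈-tabulate : ∀ {k} (f : Fin k → Bool) x → x ∈ tabulate f ⇔ f x ≡ true
  ∈-tabulate f x = mk⇔ (λ h → trans (sym (lookup∘tabulate f x)) ([]=⇒lookup h))
                       (λ h → lookup⇒[]= x (tabulate f) (trans (lookup∘tabulate f x) h))

  -- A union of classes of a partition is a union of classes of any finer one.
  transport : {k l : ℕ} {f : Fin n → Fin n → Fin k} (g : Fin n → Fin n → Fin l) →
              (∀ s → ∃₂ λ α β → f α β ≡ s) → f ⊑ g →
              (U : Subset l) → ∃ λ (V : Subset k) → ∀ α β → g α β ∈ U ⇔ f α β ∈ V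
  transport {f = f} g onto f⊑g U = tabulate φ , λ α β → mk⇔
      (λ h → from (∈-tabulate φ (f α β)) (trans (cong (lookup U) (g-rep α β)) ([]=⇒lookup h)))
      (λ h → lookup⇒[]= (g α β) U
               (trans (sym (cong (lookup U) (g-rep α β))) (to (∈-tabulate φ (f α β)) h)))
    where
    rep : ∀ s → Fin _
    rep s = g (proj₁ (onto s)) (proj₁ (proj₂ (onto s)))
    φ : Fin _ → Bool
    φ s = lookup U (rep s)
    g-rep : ∀ α β → rep (f α β) ≡ g α β
    g-rep α β = f⊑g _ _ _ _ (proj₂ (proj₂ (onto (f α β))))

IsFission⇒⊑ : (X Y : CoherentConfiguration n) → IsFission X Y →
              CoherentConfiguration.r Y ⊑ CoherentConfiguration.r X
IsFission⇒⊑ X Y fis α β α′ β′ eq with V , h ← fis ⁅ CoherentConfiguration.r X α β ⁆ =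
  sym (x∈⁅y⁆⇒x≡y _ (from (h α′ β′) (subst (_∈ V) eq (to (h α β) (x∈⁅x⁆ _)))))

⊑⇒IsFission : (X Y : CoherentConfiguration n) →
              CoherentConfiguration.r Y ⊑ CoherentConfiguration.r X → IsFission X Y
⊑⇒IsFission X Y = transport (CoherentConfiguration.r X) (CoherentConfiguration.nonempty Y)

fiber-point : (Z : CoherentConfiguration n) → ∀ {β γ δ} → IsFiber Z ⁅ β ⁆ →
              CoherentConfiguration.r Z β β ≡ CoherentConfiguration.r Z γ δ → γ ≡ β × δ ≡ β
fiber-point Z {β} {γ} {δ} (s , h) eq
  with refl , γ∈ ← to (h γ δ) (trans (sym eq) (from (h β β) (refl , x∈⁅x⁆ β)))
  = x∈⁅y⁆⇒x≡y β γ∈ , x∈⁅y⁆⇒x≡y β γ∈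

private
  module _ (B : Subset n) where

    mark : Fin n → Fin n → Maybe (Fin n)
    mark α β with (α ≟ β) ×-dec (α ∈? B)
    ... | yes _ = just α
    ... | no _  = nothing

    mark-∈ : ∀ {β} → β ∈ B → mark β β ≡ just β
    mark-∈ {β} β∈B with (β ≟ β) ×-dec (β ∈? B)
    ... | yes _ = refl
    ... | no ¬h = contradiction (refl , β∈B) ¬h

    mark-just : ∀ {α β γ} → mark α β ≡ just γ → α ≡ β × α ≡ γ
    mark-just {α} {β} eq with (α ≟ β) ×-dec (α ∈? B)
    mark-just eq | yes (α≡β , _) = α≡β , just-injective eq
    mark-just () | no _

    mark-⊑ : (Z : CoherentConfiguration n) → (∀ β → β ∈ B → IsFiber Z ⁅ β ⁆) → ∀ α β α′ β′ →
             CoherentConfiguration.r Z α β ≡ CoherentConfiguration.r Z α′ β′ → mark α β ≡ mark α′ β′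
    mark-⊑ Z fib α β α′ β′ eq with (α ≟ β) ×-dec (α ∈? B) | (α′ ≟ β′) ×-dec (α′ ∈? B)
    ... | yes (refl , α∈B) | yes _ = cong just (sym (proj₁ (fiber-point Z (fib α α∈B) eq)))
    ... | no _ | no _ = refl
    ... | yes (refl , α∈B) | no ¬h with refl , refl ← fiber-point Z (fib α α∈B) eq =
      contradiction (refl , α∈B) ¬h
    ... | no ¬h | yes (refl , α′∈B) with refl , refl ← fiber-point Z (fib α′ α′∈B) (sym eq) =
      contradiction (refl , α′∈B) ¬h

  module _ (X : CoherentConfiguration n) (B : Subset n) where
    private
      module X = CoherentConfiguration X

    initial : Σ (Colouring n) λ C →
              ∀ α β α′ β′ → Colouring.colour C α β ≡ Colouring.colour C α′ β′ ⇔
              (X.r α β ≡ X.r α′ β′ × mark B α β ≡ mark B α′ β′)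
    initial = classify²
      {_~_ = λ (α , β) (α′ , β′) → X.r α β ≡ X.r α′ β′ × mark B α β ≡ mark B α′ β′}
      (λ (α , β) (α′ , β′) → (X.r α β ≟ X.r α′ β′) ×-dec Maybe-≡-dec _≟_ (mark B α β) (mark B α′ β′))
      (λ _ → refl , refl)
      (λ (e , e′) → sym e , sym e′)
      (λ (e , e′) (f , f′) → trans e f , trans e′ f′)

    construct : ∃ (IsSmallestFissionFixing X B)
    construct with C , h ← initial
      with D , stable , D⊑C , least ← stabilise C (<-wellFounded _)
      = Y , (⊑⇒IsFission X Y D⊑X , fib) ,
        λ Z (fis , fibZ) → ⊑⇒IsFission Y Z (least Z λ α β α′ β′ e →
          from (h α β α′ β′) (IsFission⇒⊑ X Z fis α β α′ β′ e , mark-⊑ B Z fibZ α β α′ β′ e))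
      where
      open Colouring D
      D⊑X : colour ⊑ X.r
      D⊑X α β α′ β′ e = proj₁ (to (h α β α′ β′) (D⊑C α β α′ β′ e))
      diag : ∃ λ (V : Subset size) → ∀ α β → colour α β ∈ V ⇔ α ≡ β
      diag with U , hU ← X.diagonal with V , hV ← transport X.r onto D⊑X U =
        V , λ α β → mk⇔ (λ i → to (hU α β) (from (hV α β) i)) (λ e → to (hV α β) (from (hU α β) e))
      conv : ∀ s → ∃ λ s* → ∀ α β → colour β α ≡ s* ⇔ colour α β ≡ s
      conv s with γ , δ , refl ← onto s = colour δ γ , λ α β →
        mk⇔ (λ e → proj₁ (proj₂ (stable β α δ γ e))) (λ e → proj₁ (proj₂ (stable α β γ δ e)))
      Y : CoherentConfiguration n
      Y = record
        { rank = size ; r = colour ; nonempty = onto ; diagonal = diag ; converse = conv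
        ; coherent = λ u v t e e′ → proj₂ (proj₂ (stable _ _ _ _ (trans e (sym e′)))) u v }
      fib : ∀ β → β ∈ B → IsFiber Y ⁅ β ⁆
      fib β β∈B = colour β β , λ γ δ → mk⇔ (fwd γ δ) (bwd γ δ)
        where
        fwd : ∀ γ δ → colour γ δ ≡ colour β β → γ ≡ δ × γ ∈ ⁅ β ⁆
        fwd γ δ e with γ≡δ , γ≡β ← mark-just B (trans (proj₂ (to (h _ _ _ _) (D⊑C _ _ _ _ e))) (mark-∈ B β∈B)) =
          γ≡δ , subst (_∈ ⁅ β ⁆) (sym γ≡β) (x∈⁅x⁆ β)
        bwd : ∀ γ δ → γ ≡ δ × γ ∈ ⁅ β ⁆ → colour γ δ ≡ colour β β
        bwd γ δ (refl , γ∈) with refl ← x∈⁅y⁆⇒x≡y β γ∈ = refl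

abstract
  smallestFission : (X : CoherentConfiguration n) (B : Subset n) → ∃ (IsSmallestFissionFixing X B)
  smallestFission = construct

-- IsSmallestFissionFixing determines the configuration up to the numbering of
-- its basic relations (mutual IsFission).
fixing : CoherentConfiguration n → Subset n → CoherentConfiguration n
fixing X B = proj₁ (smallestFission X B)

onePointExtension : CoherentConfiguration n → Fin n → CoherentConfiguration n
onePointExtension X α = fixing X ⁅ α ⁆

IsBase : CoherentConfiguration n → Subset n → Set
IsBase X B = Complete (fixing X B)

HasBaseOfSize : CoherentConfiguration n → ℕ → Set
HasBaseOfSize X k = ∃ λ B → ∣ B ∣ ≡ k × IsBase X B

private
  complete? : (X : CoherentConfiguration n) → Dec (Complete X)
  complete? X = all? λ s → any? λ α → any? λ β → all? λ γ → all? λ δ →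
      ⇔-dec (r γ δ ≟ s) ((γ ≟ α) ×-dec (δ ≟ β))
    where
    open CoherentConfiguration X
    ⇔-dec : {P Q : Set} → Dec P → Dec Q → Dec (P ⇔ Q)
    ⇔-dec P? Q? = map′ (λ (f , g) → mk⇔ f g) (λ e → to e , from e) ((P? →-dec Q?) ×-dec (Q? →-dec P?))

  allFibers⇒Complete : (X : CoherentConfiguration n) → (∀ β → IsFiber X ⁅ β ⁆) → Complete X
  allFibers⇒Complete X fib s with α , β , refl ← CoherentConfiguration.nonempty X s = α , β , λ γ δ →
      mk⇔ (λ e → source e , source (r-converse X e)) (λ { (refl , refl) → refl })
    where
    open CoherentConfiguration X
    -- The triangle (γ , γ , δ) must be matched by a triangle (α , ε , β) with r α ε ≡ r γ γ.
    source : ∀ {α β γ δ} → r γ δ ≡ r α β → γ ≡ α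
    source {α} {β} {γ} {δ} e
      with filter (λ ε → r α ε ≟ r γ γ) (allFin _) in eqα | coherent⁺ X (λ (u , _) → u ≟ r γ γ) e
    ... | [] | e′ = contradiction (subst (γ List.∈_) (length-0 e′) (∈-filter⁺ (λ ε → r γ ε ≟ r γ γ) (∈-allFin γ) refl)) λ ()
      where
      length-0 : {xs : List A} → length xs ≡ 0 → xs ≡ []
      length-0 {xs = []} _ = refl
    ... | ε ∷ _ | _ = sym (proj₁ (fiber-point X (fib γ) (sym (proj₂
        (∈-filter⁻ (λ ε → r α ε ≟ r γ γ) {xs = allFin _} (subst (ε List.∈_) (sym eqα) (here refl)))))))

  least : {P : Pred ℕ p} → Decidable P → ∀ k → P k → ∃ λ m → P m × (∀ j → P j → m ≤ j)
  least P? k pk with P? 0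
  least P? k       pk | yes p0 = 0 , p0 , λ _ _ → z≤n
  least P? zero    pk | no ¬p0 = contradiction pk ¬p0
  least P? (suc k) pk | no ¬p0 with m , pm , m≤ ← least (λ j → P? (suc j)) k pk =
    suc m , pm , λ { zero p0 → contradiction p0 ¬p0 ; (suc j) pj → s≤s (m≤ j pj) }

abstract
  minimalBase : (X : CoherentConfiguration n) →
                ∃ λ k → HasBaseOfSize X k × (∀ j → HasBaseOfSize X j → k ≤ j)
  minimalBase {n = n} X = least
    (λ k → anySubset? λ B → (∣ B ∣ ≟ℕ k) ×-dec complete? (fixing X B)) ∣ ⊤ {n} ∣
    (⊤ , refl , allFibers⇒Complete (fixing X ⊤) λ β → proj₂ (proj₁ (proj₂ (smallestFission X ⊤))) β ∈⊤)

b : CoherentConfiguration n → ℕ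
b X = proj₁ (minimalBase X)

{-# OPTIONS --safe #-}

-- Call δ ambiguous for γ if some δ′ ≠ δ satisfies r(α,δ′) = r(α,δ) and
-- r(δ′,γ) = r(δ,γ).  For each δ there are at most m − 1 candidates δ′, and
-- each of them serves at most c points γ; averaging gives a point γ for which
-- at most (m − 1)c points are ambiguous.  In X_α an unambiguous point ε is the
-- only one in its relation to γ, so if δ and δ′ are in the same relation of
-- X_α to γ, then so are they to ε.  Hence δ ≠ δ′ would give n ≤ (m − 1)c + c,
-- which is at most 4c(m − 1) because r(α,δ) = r(α,δ′) forces m ≥ 2.  The point
-- γ thus separates all points in X_α, and {α , γ} is a base of X.
module Submission where

open import Defs
open import Data.Fin.Base using (Fin; fromℕ<)
open import Data.Fin.Properties using (_≟_; any?)
open import Data.Fin.Subset using (Subset; ⁅_⁆; _∪_; ∣_∣)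
open import Data.Fin.Subset.Properties using (x∈⁅x⁆; ∣⁅x⁆∣≡1; x∈p∪q⁺)
open import Data.List.Base using (List; []; _∷_; map; filter; length; allFin)
open import Data.List.Extrema.Nat using (xs≤max)
open import Data.List.Membership.Propositional as List using ()
open import Data.List.Membership.Propositional.Properties using (∈-allFin; ∈-filter⁺; ∈-filter⁻; ∈-map⁺; ∈-length)
open import Data.List.Properties using (filter-notAll; length-tabulate; map-cong)
open import Data.List.Relation.Unary.All as All using (_∷_)
open import Data.List.Relation.Unary.Any as Any using (here; there)
open import Data.List.Relation.Unary.AllPairs using (_∷_)
open import Data.List.Relation.Unary.Unique.Propositional using (Unique)
open import Data.List.Relation.Unary.Unique.Propositional.Properties using (allFin⁺; filter⁺)
open import Data.Nat.Base using (ℕ; suc; _+_; _*_; _∸_; _≤_; _<_; z≤n; s≤s; s≤s⁻¹; NonZero; >-nonZero)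
open import Data.Nat.ListAction using (sum)
open import Data.Nat.Properties hiding (_≟_)
open import Data.Bool.Base using (true; false)
open import Data.Vec.Base using ([]; _∷_)
open import Data.Product.Base using (∃; _×_; _,_; proj₁; proj₂; map₂)
open import Data.Sum.Base using (_⊎_; inj₁; inj₂)
open import Function.Base using (id; _∘_)
open import Function.Bundles using (mk⇔; Equivalence)
open import Level using (Level)
open import Relation.Binary.PropositionalEquality using (_≡_; _≢_; refl; sym; trans; cong; cong₂; subst; module ≡-Reasoning)
open import Relation.Nullary using (Dec; yes; no; contradiction)
open import Relation.Nullary.Decidable using (_×-dec_; ¬?; decidable-stable)
open import Relation.Unary using (Pred; Decidable)
open import Algebra.Properties.CommutativeSemigroup +-commutativeSemigroup using (interchange)

open Equivalence using (to)

private
  variable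
    a b′ p q : Level
    A : Set a
    B : Set b′
    n : ℕ

-- Counting over lists and subsets: averaging, double counting, union bounds.

sum-map-≤ : (f : A → ℕ) (k : ℕ) (xs : List A) → (∀ {x} → x List.∈ xs → f x ≤ k) →
            sum (map f xs) ≤ length xs * k
sum-map-≤ f k []       f≤k = z≤n
sum-map-≤ f k (x ∷ xs) f≤k = +-mono-≤ (f≤k (here refl)) (sum-map-≤ f k xs (f≤k ∘ there))

sum-map-+ : (f g : A → ℕ) (xs : List A) →
            sum (map (λ x → f x + g x) xs) ≡ sum (map f xs) + sum (map g xs)
sum-map-+ f g []       = refl
sum-map-+ f g (x ∷ xs) =
  trans (cong (f x + g x +_) (sum-map-+ f g xs)) (interchange (f x) (g x) _ _)

sum-<⇒∃< : (f : A → ℕ) (k : ℕ) (xs : List A) → sum (map f xs) < length xs * k → ∃ λ x → f x < k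
sum-<⇒∃< f k (x ∷ xs) lt with f x <? k
... | yes fx<k = x , fx<k
... | no  fx≮k = sum-<⇒∃< f k xs
  (+-cancelˡ-< k _ _ (≤-<-trans (+-monoˡ-≤ (sum (map f xs)) (≮⇒≥ fx≮k)) lt))

length-filter-⊎ : {P : Pred A p} {Q : Pred A q} (P? : Decidable P) (Q? : Decidable Q) →
                  (∀ x → P x ⊎ Q x) → ∀ xs → length xs ≤ length (filter P? xs) + length (filter Q? xs)
length-filter-⊎ P? Q? cover [] = z≤n
length-filter-⊎ P? Q? cover (x ∷ xs) with ih ← length-filter-⊎ P? Q? cover xs | P? x | Q? x
... | yes _ | yes _ = s≤s (≤-trans ih (+-monoʳ-≤ (length (filter P? xs)) (n≤1+n _)))
... | yes _ | no _  = s≤s ih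
... | no _  | yes _ = ≤-trans (s≤s ih) (≤-reflexive (sym (+-suc _ _)))
... | no ¬p | no ¬q with cover x
...   | inj₁ px = contradiction px ¬p
...   | inj₂ qx = contradiction qx ¬q

module _ {R : A → B → Set p} (R? : ∀ x y → Dec (R x y)) where

  row : A → List B → ℕ
  row x ys = length (filter (R? x) ys)

  column : List A → B → ℕ
  column xs y = length (filter (λ x → R? x y) xs)

  double-counting : ∀ xs ys → sum (map (λ x → row x ys) xs) ≡ sum (map (column xs) ys)
  double-counting [] ys = sym (n≤0⇒n≡0 (≤-trans (sum-map-≤ (column []) 0 ys (λ _ → z≤n))
                                                (≤-reflexive (*-zeroʳ (length ys)))))
  double-counting (x ∷ xs) ys = begin
    row x ys + sum (map (λ z → row z ys) xs)             ≡⟨ cong₂ _+_ (indicators ys) (double-counting xs ys) ⟩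
    sum (map (column (x ∷ [])) ys) + sum (map (column xs) ys) ≡⟨ sum-map-+ (column (x ∷ [])) (column xs) ys ⟨
    sum (map (λ y → column (x ∷ []) y + column xs y) ys) ≡⟨ cong sum (map-cong split ys) ⟩
    sum (map (column (x ∷ xs)) ys)                       ∎
    where
    open ≡-Reasoning
    indicators : ∀ ys → row x ys ≡ sum (map (column (x ∷ [])) ys)
    indicators []       = refl
    indicators (y ∷ ys) with R? x y
    ... | yes _ = cong suc (indicators ys)
    ... | no _  = indicators ys
    split : ∀ y → column (x ∷ []) y + column xs y ≡ column (x ∷ xs) y
    split y with R? x y
    ... | yes _ = refl
    ... | no _  = refl

  -- Every `y` satisfying `P` has a nonempty column over `xs`, so the count is at most the sum of
  -- the columns, which double counting turns into the sum of the rows.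
  union-bound : {P : Pred B q} (P? : Decidable P) (xs : List A) →
                (∀ {y} → P y → ∃ λ x → x List.∈ xs × R x y) →
                ∀ ys → length (filter P? ys) ≤ sum (map (λ x → row x ys) xs)
  union-bound P? xs cover ys = ≤-trans (bound ys) (≤-reflexive (sym (double-counting xs ys)))
    where
    bound : ∀ ys → length (filter P? ys) ≤ sum (map (column xs) ys)
    bound [] = z≤n
    bound (y ∷ ys) with P? y
    ... | no _  = ≤-trans (bound ys) (m≤n+m _ (column xs y))
    ... | yes py with x , x∈xs , rxy ← cover py =
      +-mono-≤ (∈-length (∈-filter⁺ (λ x → R? x y) x∈xs rxy)) (bound ys)

Unique⇒length≤1 : {xs : List A} → Unique xs → (∀ {x y} → x List.∈ xs → y List.∈ xs → x ≡ y) →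
                  length xs ≤ 1
Unique⇒length≤1 {xs = []}         _                 eq = z≤n
Unique⇒length≤1 {xs = x ∷ []}     _                 eq = s≤s z≤n
Unique⇒length≤1 {xs = x ∷ y ∷ xs} ((x≢y ∷ _) ∷ _)  eq =
  contradiction (eq (here refl) (there (here refl))) x≢y

#-witness : {P : Pred (Fin n) p} {Q : Pred (Fin n) q} (P? : Decidable P) (Q? : Decidable Q) →
            # P? ≡ # Q? → ∀ {x} → P x → ∃ Q
#-witness {n = n} P? Q? eq {x} px with filter Q? (allFin n) in eqQ
... | y ∷ _ = y , proj₂ (∈-filter⁻ Q? {xs = allFin n} (subst (y List.∈_) (sym eqQ) (here refl)))
... | []    = contradiction (subst (0 <_) eq (∈-length (∈-filter⁺ P? (∈-allFin x) px))) λ ()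

∣p∪q∣≤∣p∣+∣q∣ : (p q : Subset n) → ∣ p ∪ q ∣ ≤ ∣ p ∣ + ∣ q ∣
∣p∪q∣≤∣p∣+∣q∣ []          []          = z≤n
∣p∪q∣≤∣p∣+∣q∣ (true  ∷ p) (true  ∷ q) = s≤s (≤-trans (∣p∪q∣≤∣p∣+∣q∣ p q) (+-monoʳ-≤ ∣ p ∣ (n≤1+n ∣ q ∣)))
∣p∪q∣≤∣p∣+∣q∣ (true  ∷ p) (false ∷ q) = s≤s (∣p∪q∣≤∣p∣+∣q∣ p q)
∣p∪q∣≤∣p∣+∣q∣ (false ∷ p) (true  ∷ q) = ≤-trans (s≤s (∣p∪q∣≤∣p∣+∣q∣ p q)) (≤-reflexive (sym (+-suc ∣ p ∣ ∣ q ∣)))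
∣p∪q∣≤∣p∣+∣q∣ (false ∷ p) (false ∷ q) = ∣p∪q∣≤∣p∣+∣q∣ p q

-- Triangles, fibers and separating points in a coherent configuration.

module _ (X : CoherentConfiguration n) where
  open CoherentConfiguration X

  -- The intersection number for the colours of the triangle with apex `γ` is positive over
  -- `(α , β)`, hence also over `(α′ , β′)`.
  r-triangle : ∀ {α β α′ β′} → r α β ≡ r α′ β′ → ∀ γ →
               ∃ λ γ′ → r α′ γ′ ≡ r α γ × r γ′ β′ ≡ r γ β
  r-triangle {α} {β} {α′} {β′} eq γ = #-witness
    (λ ε → (r α ε ≟ r α γ) ×-dec (r ε β ≟ r γ β)) (λ ε → (r α′ ε ≟ r α γ) ×-dec (r ε β′ ≟ r γ β))
    (coherent _ _ _ refl (sym eq)) (refl , refl)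

  -- Transport the degenerate triangle with apex `α`: its new apex has a diagonal colour from `α′`,
  -- so it is `α′` itself.
  r-source : ∀ {α β α′ β′} → r α β ≡ r α′ β′ → r α α ≡ r α′ α′
  r-source {α} eq with γ , e , _ ← r-triangle eq α with refl ← r-diagonal X (sym e) = sym e

  -- Transport the triangle with apex `φ`. The new apex has the same loop colour as `φ`, and the
  -- fiber of `φ` is a singleton, so the apex stays put.
  fixed-source : ∀ {φ} → IsFiber X ⁅ φ ⁆ → ∀ {α β α′ β′} → r α β ≡ r α′ β′ → r φ α ≡ r φ α′
  fixed-source {φ} fib eq with γ , e , _ ← r-triangle eq φ
    with refl , _ ← fiber-point X fib (r-source (r-converse X (sym e))) = r-converse X (sym e)

  Separates : Fin n → Set
  Separates γ = ∀ {δ δ′} → r γ δ ≡ r γ δ′ → δ ≡ δ′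

  separates⇒outdegree≤1 : ∀ {γ} → Separates γ → ∀ t → outdegree X γ t ≤ 1
  separates⇒outdegree≤1 {γ} sep t = Unique⇒length≤1 (filter⁺ (λ β → r γ β ≟ t) (allFin⁺ n))
    λ δ∈ δ′∈ → sep (trans (∈⇒r δ∈) (sym (∈⇒r δ′∈)))
    where
    ∈⇒r : ∀ {δ} → δ List.∈ filter (λ β → r γ β ≟ t) (allFin n) → r γ δ ≡ t
    ∈⇒r δ∈ = proj₂ (∈-filter⁻ (λ β → r γ β ≟ t) {xs = allFin n} δ∈)

  -- Since `γ` is fixed, the colour of a pair determines the colour from `γ` to its first point,
  -- hence that point; the converse pair gives the second.
  separates⇒complete : ∀ {γ} → IsFiber X ⁅ γ ⁆ → Separates γ → Complete X
  separates⇒complete fib sep s with α , β , refl ← nonempty s = α , β , λ γ δ → mk⇔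
    (λ e → sep (fixed-source fib e) , sep (fixed-source fib (r-converse X e)))
    (λ { (refl , refl) → refl })

-- Fixing both points gives a fission of the one-point extension. Separation by `γ` survives in any
-- finer configuration, and there `γ` is also a fiber.
separates⇒b≤2 : (X : CoherentConfiguration n) → ∀ {α γ} →
                Separates (onePointExtension X α) γ → b X ≤ 2
separates⇒b≤2 X {α} {γ} sep = begin
  b X                   ≤⟨ proj₂ (proj₂ (minimalBase X)) ∣ B₂ ∣ (B₂ , refl , complete) ⟩
  -- Only an inequality, since `γ` may equal `α`.
  ∣ B₂ ∣                ≤⟨ ∣p∪q∣≤∣p∣+∣q∣ ⁅ α ⁆ ⁅ γ ⁆ ⟩
  ∣ ⁅ α ⁆ ∣ + ∣ ⁅ γ ⁆ ∣ ≡⟨ cong₂ _+_ (∣⁅x⁆∣≡1 α) (∣⁅x⁆∣≡1 γ) ⟩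
  2                     ∎
  where
  open ≤-Reasoning
  B₂ = ⁅ α ⁆ ∪ ⁅ γ ⁆
  Y = onePointExtension X α
  Z = fixing X B₂
  Z-fixing : IsFissionFixing X B₂ Z
  Z-fixing = proj₁ (proj₂ (smallestFission X B₂))
  Z⊑Y : CoherentConfiguration.r Z ⊑ CoherentConfiguration.r Y
  Z⊑Y = IsFission⇒⊑ Y Z (proj₂ (proj₂ (smallestFission X ⁅ α ⁆)) Z
    (proj₁ Z-fixing , λ β β∈ → proj₂ Z-fixing β (x∈p∪q⁺ (inj₁ β∈))))
  complete : Complete Z
  complete = separates⇒complete Z (proj₂ Z-fixing γ (x∈p∪q⁺ (inj₂ (x∈⁅x⁆ γ))))
    (λ e → sep (Z⊑Y _ _ _ _ e))

-- Bounds on ambiguous points in a scheme.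

module _ (X : Scheme n) where
  open Scheme X

  outdegree≤nₘₐₓ : ∀ α s → outdegree config α s ≤ nₘₐₓ X
  outdegree≤nₘₐₓ α s = subst (_≤ nₘₐₓ X) (sym (valency-wd X α s))
    (All.lookup (xs≤max 0 (map (valency X) (allFin rank))) (∈-map⁺ (valency X) (∈-allFin s)))

  indistinguishing≤cₘₐₓ : ∀ {α β} → α ≢ β → indistinguishing config α β ≤ cₘₐₓ X
  indistinguishing≤cₘₐₓ {α} {β} α≢β = subst (_≤ cₘₐₓ X) (sym (c-wd X α β))
    (All.lookup (xs≤max 0 (map (c X) (filter (λ s → ¬? (s ≟ 1Ω)) (allFin rank))))
      (∈-map⁺ (c X) (∈-filter⁺ (λ s → ¬? (s ≟ 1Ω)) (∈-allFin (r α β))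
        (α≢β ∘ to (1Ω-equal α β)))))

  module _ (α : Fin n) where

    Ambiguous : Fin n → Fin n → Set
    Ambiguous γ δ = ∃ λ δ′ → (δ′ ≢ δ × r α δ′ ≡ r α δ) × r δ′ γ ≡ r δ γ

    ambiguous? : ∀ γ δ → Dec (Ambiguous γ δ)
    ambiguous? γ δ = any? λ δ′ → (¬? (δ′ ≟ δ) ×-dec (r α δ′ ≟ r α δ)) ×-dec (r δ′ γ ≟ r δ γ)

    others : Fin n → List (Fin n)
    others δ = filter (λ δ′ → ¬? (δ′ ≟ δ)) (filter (λ δ′ → r α δ′ ≟ r α δ) (allFin n))

    ∈-others⁺ : ∀ {δ δ′} → δ′ ≢ δ → r α δ′ ≡ r α δ → δ′ List.∈ others δ
    ∈-others⁺ {δ} {δ′} δ′≢δ e = ∈-filter⁺ (λ δ′ → ¬? (δ′ ≟ δ))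
      (∈-filter⁺ (λ δ′ → r α δ′ ≟ r α δ) (∈-allFin δ′) e) δ′≢δ

    -- The `1` is `δ` itself: it lies in its own class seen from `α` and is filtered out.
    length-others : ∀ δ → length (others δ) ≤ nₘₐₓ X ∸ 1
    length-others δ = ∸-monoˡ-≤ 1 (≤-trans
      (filter-notAll (λ δ′ → ¬? (δ′ ≟ δ)) _
        (Any.map (λ { refl ¬refl → ¬refl refl })
          (∈-filter⁺ (λ δ′ → r α δ′ ≟ r α δ) (∈-allFin δ) refl)))
      (outdegree≤nₘₐₓ α (r α δ)))

    ambiguous-column : ∀ δ → # (λ γ → ambiguous? γ δ) ≤ (nₘₐₓ X ∸ 1) * cₘₐₓ X
    ambiguous-column δ = begin
      # (λ γ → ambiguous? γ δ)
        ≤⟨ union-bound (λ δ′ γ → r δ′ γ ≟ r δ γ) (λ γ → ambiguous? γ δ) (others δ)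
             (λ (δ′ , (δ′≢δ , e) , e′) → δ′ , ∈-others⁺ δ′≢δ e , e′) (allFin n) ⟩
      -- The row of `δ′` is by definition the set of points that fail to distinguish `δ′` from `δ`.
      sum (map (λ δ′ → indistinguishing config δ′ δ) (others δ))
        ≤⟨ sum-map-≤ _ (cₘₐₓ X) (others δ)
             (λ δ′∈ → indistinguishing≤cₘₐₓ (proj₂ (∈-filter⁻ (λ δ′ → ¬? (δ′ ≟ δ))
               {xs = filter (λ δ′ → r α δ′ ≟ r α δ) (allFin n)} δ′∈))) ⟩
      length (others δ) * cₘₐₓ X
        ≤⟨ *-monoˡ-≤ (cₘₐₓ X) (length-others δ) ⟩
      (nₘₐₓ X ∸ 1) * cₘₐₓ X ∎
      where open ≤-Reasoning

    few-ambiguous : ∃ λ γ → # (ambiguous? γ) ≤ (nₘₐₓ X ∸ 1) * cₘₐₓ X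
    few-ambiguous =
      -- Averaging yields a strict bound, so it is applied with `suc k` and then weakened to `k`.
      map₂ s≤s⁻¹ (sum-<⇒∃< (λ γ → # (ambiguous? γ)) (suc k) (allFin n) total)
      where
      k = (nₘₐₓ X ∸ 1) * cₘₐₓ X
      instance
        -- The point `α` shows that the list is nonempty, as the strict step of `total` requires.
        allFin≢[] : NonZero (length (allFin n))
        allFin≢[] = >-nonZero (∈-length (∈-allFin α))
      total : sum (map (λ γ → # (ambiguous? γ)) (allFin n)) < length (allFin n) * suc k
      total = begin-strict
        sum (map (λ γ → # (ambiguous? γ)) (allFin n))
          ≡⟨ double-counting ambiguous? (allFin n) (allFin n) ⟩
        sum (map (λ δ → # (λ γ → ambiguous? γ δ)) (allFin n))
          ≤⟨ sum-map-≤ _ k (allFin n) (λ {δ} _ → ambiguous-column δ) ⟩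
        length (allFin n) * k
          <⟨ *-monoʳ-< (length (allFin n)) (n<1+n k) ⟩
        length (allFin n) * suc k ∎
        where open ≤-Reasoning

    -- Separation in a fission fixing `α`.

    separating-point : 4 * cₘₐₓ X * (nₘₐₓ X ∸ 1) < n →
                       (Y : CoherentConfiguration n) → IsFissionFixing config ⁅ α ⁆ Y →
                       ∃ (Separates Y)
    separating-point small Y (fis , fixes) with γ , few ← few-ambiguous = γ , sep
      where
      module Y = CoherentConfiguration Y
      Y⊑X : Y.r ⊑ r
      Y⊑X = IsFission⇒⊑ config Y fis

      -- This is where the fiber of `α` enters: colours of `Y` determine the relation to `α`.
      same-α : ∀ {γ δ δ′} → Y.r γ δ ≡ Y.r γ δ′ → r α δ ≡ r α δ′
      same-α e = Y⊑X _ _ _ _ (fixed-source Y (fixes α (x∈⁅x⁆ α)) (r-converse Y e))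

      -- Move the triangle with apex `ε` from `(γ , δ)` to `(γ , δ′)`. If the apex stays, `δ` and
      -- `δ′` look alike from `ε`; if it moves, the new apex witnesses that `ε` is ambiguous.
      cover : ∀ {δ δ′} → Y.r γ δ ≡ Y.r γ δ′ → ∀ ε → Ambiguous γ ε ⊎ r δ ε ≡ r δ′ ε
      cover e ε with ε′ , e₁ , e₂ ← r-triangle Y e ε with ε′ ≟ ε
      ... | yes refl = inj₂ (Y⊑X _ _ _ _ (sym (r-converse Y e₂)))
      ... | no ε′≢ε  = inj₁ (ε′ , (ε′≢ε , same-α e₁) , Y⊑X _ _ _ _ (r-converse Y e₁))

      sep : Separates Y γ
      sep {δ} {δ′} e = decidable-stable (δ ≟ δ′) λ δ≢δ′ → <-irrefl refl (begin-strict
        n                                             ≡⟨ length-tabulate {n = n} id ⟨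
        length (allFin n)                             ≤⟨ length-filter-⊎ (ambiguous? γ) (λ ε → r δ ε ≟ r δ′ ε) (cover e) (allFin n) ⟩
        # (ambiguous? γ) + indistinguishing config δ δ′ ≤⟨ +-mono-≤ few (indistinguishing≤cₘₐₓ δ≢δ′) ⟩
        k * C + C                                     ≤⟨ +-monoʳ-≤ (k * C) (≤-trans (≤-reflexive (sym (*-identityˡ C))) (*-monoˡ-≤ C (k≥1 δ≢δ′))) ⟩
        k * C + k * C                                 ≡⟨ *-distribʳ-+ C k k ⟨
        (k + k) * C                                   ≡⟨ *-comm (k + k) C ⟩
        -- Here `4 * k` unfolds to `k + (k + (k + (k + 0)))`.
        C * (k + k)                                   ≤⟨ *-monoʳ-≤ C (+-monoʳ-≤ k (m≤m+n k (k + (k + 0)))) ⟩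
        C * (4 * k)                                   ≡⟨ *-assoc C 4 k ⟨
        C * 4 * k                                     ≡⟨ cong (_* k) (*-comm C 4) ⟩
        4 * C * k                                     <⟨ small ⟩
        n                                             ∎)
        where
        open ≤-Reasoning
        k = nₘₐₓ X ∸ 1
        C = cₘₐₓ X
        -- The point `δ` is a member of `others δ′`, so that list is nonempty.
        k≥1 : δ ≢ δ′ → 1 ≤ k
        k≥1 δ≢δ′ = ≤-trans (∈-length (∈-others⁺ δ≢δ′ (same-α e))) (length-others δ′)

theorem8p1 : ∀ (n : ℕ) (X : Scheme n) → 4 * cₘₐₓ X * (nₘₐₓ X ∸ 1) < n →
    ((α : Fin n) → OneRegular (onePointExtension (Scheme.config X) α)) × (b (Scheme.config X) ≤ 2)
-- The bound on `b` needs some point to extend at; `small` supplies one, as it makes `n` positive.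
theorem8p1 n X small = oneRegular , separates⇒b≤2 config (proj₂ (separating (fromℕ< small)))
  where
  open Scheme X using (config)

  separating : ∀ α → ∃ (Separates (onePointExtension config α))
  separating α = separating-point X α small (onePointExtension config α)
    (proj₁ (proj₂ (smallestFission config ⁅ α ⁆)))

  oneRegular : ∀ α → OneRegular (onePointExtension config α)
  oneRegular α =
    map₂ (λ {γ} → separates⇒outdegree≤1 (onePointExtension config α) {γ}) (separating α)
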